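{- Let $n\ge 2$ and consider the absent-minded passengers process with one absent-minded passenger: there are $n$ seats labelled $1,\dots,n$ and $n$ passengers labelled $1,\dots,n$, where the correct seat of passenger $i$ is seat $i$. Passengers board in the order $1,\dots,n$; passenger $1$ chooses a seat uniformly at random among all $n$ seats; each passenger $i\ge 2$ takes seat $i$ if it is empty and otherwise chooses uniformly at random among the currently empty seats. Let $X_n$ be the number of passengers who end up in a seat other than their own. For $r\ge1$ write $H_r=\sum_{i=1}^{n-1} i^{ -r}$, and let $m_s(X_n)=E[(X_n-E[X_n])^s]$. Then $$E[X_n]=H_1,\qquad \mathrm{Var}[X_n]=\frac{nH_1-nH_2+2H_1}{n},$$ $$m_3(X_n)=\frac{nH_1-3nH_2+2nH_3-3H_1^2+6H_1-3H_2}{n},$$ $$m_4(X_n)=\frac{3nH_1^2-6nH_1H_2+3nH_2^2+4H_1^3+nH_1-7nH_2+12nH_3-6nH_4-6H_1^2+14H_1-18H_2+8H_3}{n},$$ $$m_5(X_n)=\frac{1}{n}\Big(-5H_1^4+10nH_1^2-40nH_1H_2+20nH_1H_3+30nH_2^2-20nH_2H_3+10H_1^3+nH_1-15nH_2+50nH_3-60nH_4+24nH_5$$ $$+5H_1^2-30H_1H_2+15H_2^2+30H_1-75H_2+80H_3-30H_4\Big),$$ $$m_6(X_n)=\frac{1}{n}\Big(6H_1^5+15nH_1^3-45nH_1^2H_2+45nH_1H_2^2-15nH_2^3-15H_1^4+25nH_1^2-180nH_1H_2+220nH_1H_3-90nH_1H_4$$ $$+195nH_2^2-300nH_2H_3+90nH_2H_4+40nH_3^2+20H_1^3+nH_1-31nH_2+180nH_3-390nH_4+360nH_5-120nH_6$$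 $$+90H_1^2-330H_1H_2+120H_1H_3+225H_2^2-120H_2H_3+62H_1-270H_2+520H_3-450H_4+144H_5\Big).$$
   Context: The quantities $H_r$ depend on $n$ (the upper summation limit is $n-1$, not $n$). -}

module Defs where

open import Data.Nat as ℕ using (ℕ; zero; suc)
open import Data.Integer as ℤ using (ℤ; +_)
open import Data.Rational as ℚ using (ℚ; _/_; _+_; _*_; _-_; 0ℚ; 1ℚ)
open import Data.List using (List; []; _∷_; map; concatMap; filter; length; upTo; foldr)
open import Data.List.Membership.DecPropositional ℕ._≟_ using (_∈?_)
open import Data.Product using (_×_; _,_; proj₁; proj₂)
open import Relation.Nullary using (yes; no; ¬?)

Dist : Set → Set
Dist A = List (ℚ × A)

return : {A : Set} → A → Dist A
return a = (1ℚ , a) ∷ []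

bind : {A B : Set} → Dist A → (A → Dist B) → Dist B
bind d f = concatMap (λ pa → map (λ qb → (proj₁ pa * proj₁ qb , proj₂ qb)) (f (proj₂ pa))) d

uniform : {A : Set} → List A → Dist A
uniform [] = []
uniform (x ∷ xs) = map (λ y → (+ 1 / suc (length xs) , y)) (x ∷ xs)

E : {A : Set} → Dist A → (A → ℚ) → ℚ
E d f = foldr (λ pa acc → proj₁ pa * f (proj₂ pa) + acc) 0ℚ d

-- The absent-minded passengers process (one absent-minded passenger).
-- Internally passengers and seats are labelled 0,…,n-1
-- (label i here is label i+1 in the paper); passenger i's own seat is seat i.
-- State: list of currently empty seats, and the list of (passenger , seat)
-- assignments made so far.

State : Set
State = List ℕ × List (ℕ × ℕ)

sit : ℕ → State → ℕ → State
sit i (free , asg) j = (filter (λ x → ¬? (x ℕ.≟ j)) free , (i , j) ∷ asg)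

chooseRandom : ℕ → State → Dist State
chooseRandom i s = map (λ pj → (proj₁ pj , sit i s (proj₂ pj))) (uniform (proj₁ s))

board : ℕ → State → Dist State
board zero s = chooseRandom zero s
board (suc i) s with suc i ∈? proj₁ s
... | yes _ = return (sit (suc i) s (suc i))
... | no  _ = chooseRandom (suc i) s

boardAll : List ℕ → State → Dist State
boardAll [] s = return s
boardAll (i ∷ is) s = bind (board i s) (boardAll is)

process : ℕ → Dist State
process n = boardAll (upTo n) (upTo n , [])

misplaced : State → ℕ
misplaced (_ , asg) = length (filter (λ ij → ¬? (proj₁ ij ℕ.≟ proj₂ ij)) asg)

ℕ→ℚ : ℕ → ℚ
ℕ→ℚ k = + k / 1

Xn : State → ℚ
Xn s = ℕ→ℚ (misplaced s)

pow : ℚ → ℕ → ℚ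
pow q zero = 1ℚ
pow q (suc k) = q * pow q k

meanX : ℕ → ℚ
meanX n = E (process n) Xn

centralMoment : ℕ → ℕ → ℚ
centralMoment n s = E (process n) (λ st → pow (Xn st - meanX n) s)

varX : ℕ → ℚ
varX n = centralMoment n 2

sumTo : ℕ → (ℕ → ℚ) → ℚ
sumTo zero f = 0ℚ
sumTo (suc m) f = sumTo m f + f (suc m)

H : ℕ → ℕ → ℚ
H n r = sumTo (n ℕ.∸ 1) (λ i → + 1 / suc (ℕ.pred (i ℕ.^ r)))
-- note: i ≥ 1 so i^r ≥ 1 and suc (pred (i^r)) = i^r

invℕ : ℕ → ℚ
invℕ zero = 0ℚ
invℕ (suc k) = + 1 / suc k

{-# OPTIONS --safe #-}

-- A passenger who finds their own seat taken and m seats free (among them seat 1) makes the process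
-- orderly by taking seat 1, or passes the displacement on to the owner of the chosen seat. The
-- resulting recursion collapses to a two-term one: the number of passengers misplaced from then on is
-- distributed as a sum of independent Bernoulli(1/i) variables, i = 1, …, m. Hence its cumulants are
-- linear in the power sums Σ i⁻ʳ, and Xₙ differs from the sum for m = n only by moving mass 1/n from
-- the value 1 to the value 0 (passenger 1 may take the right seat). For 1/n to be factored out, the
-- n-th Bernoulli variable is split off; the rest is polynomial identities.

module Submission where

open import Defs
open import Data.Nat using (ℕ; _≤_)
open import Data.Rational using (ℚ; _+_; _*_; _-_)
open import Data.Product using (_×_)
open import Relation.Binary.PropositionalEquality using (_≡_)
open import Algebra.Bundles using (module CommutativeRing)
open import Algebra.Solver.Ring.AlmostCommutativeRing
  using (_-Raw-AlmostCommutative⟶_; fromCommutativeRing)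
import Algebra.Solver.Ring as RingSolver
open import Data.Fin.Base using (Fin; toℕ)
open import Data.Fin.Patterns using (0F; 1F; 2F; 3F; 4F; 5F; 6F)
open import Data.Integer.Base as ℤ using (+_)
import Data.Integer.Properties as ℤ
open import Data.List.Base using (List; []; _∷_; _++_; map; filter; length; foldr; applyUpTo; upTo)
open import Data.List.Membership.DecPropositional Data.Nat._≟_ using (_∈_; _∉_; _∈?_)
open import Data.List.Properties using (filter-all; filter-accept; filter-reject)
open import Data.List.Relation.Unary.All as All using (All; []; _∷_)
open import Data.List.Relation.Unary.All.Properties using (filter⁺; All¬⇒¬Any)
open import Data.List.Relation.Unary.Any using (here; there)
import Data.Maybe.Base as Maybe
open import Data.Nat.Base as ℕ using (zero; suc; _<_; _∸_; s≤s; z≤n)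
import Data.Nat.Properties as ℕ
open import Data.Product using (_,_; proj₁; proj₂)
open import Data.Rational using (-_; _/_; 0ℚ; 1ℚ; toℚᵘ)
open import Data.Rational.Properties
import Data.Rational.Unnormalised as ℚᵘ
import Data.Rational.Unnormalised.Properties as ℚᵘ
open import Data.Vec.Base as Vec using (Vec; []; _∷_; zipWith)
import Data.Vec.Properties as Vec
open import Function.Base using (_∘_; id)
open import Relation.Binary.PropositionalEquality
  using (_≢_; _≗_; refl; sym; trans; cong; cong₂; subst; module ≡-Reasoning)
open import Relation.Nullary using (¬?; yes; no; contradiction)
open import Relation.Nullary.Decidable using (dec⇒maybe)

-- Integers and unit fractions inside the rationals

toℚᵘ-/ : ∀ i d → toℚᵘ (i / suc d) ℚᵘ.≃ ℚᵘ.mkℚᵘ i d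
toℚᵘ-/ i d = toℚᵘ-fromℚᵘ (ℚᵘ.mkℚᵘ i d)

-- Equality in ℚ is tested on unnormalised fractions, where no gcd intervenes and
-- cross-multiplication leaves an identity of integers.
/1-homo-+ : ∀ i j → (i ℤ.+ j) / 1 ≡ i / 1 + j / 1
/1-homo-+ i j = toℚᵘ-injective (begin
  toℚᵘ ((i ℤ.+ j) / 1)            ≈⟨ toℚᵘ-/ _ 0 ⟩
  ℚᵘ.mkℚᵘ (i ℤ.+ j) 0             ≈⟨ ℚᵘ.*≡* (cong (ℤ._* + 1)
                                       (sym (cong₂ ℤ._+_ (ℤ.*-identityʳ i) (ℤ.*-identityʳ j)))) ⟩
  ℚᵘ.mkℚᵘ i 0 ℚᵘ.+ ℚᵘ.mkℚᵘ j 0    ≈⟨ ℚᵘ.+-cong (toℚᵘ-/ i 0) (toℚᵘ-/ j 0) ⟨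
  toℚᵘ (i / 1) ℚᵘ.+ toℚᵘ (j / 1)  ≈⟨ toℚᵘ-homo-+ (i / 1) (j / 1) ⟨
  toℚᵘ (i / 1 + j / 1)            ∎)
  where open ℚᵘ.≃-Reasoning

/-homo-* : ∀ i j c d → (i ℤ.* j) / (suc c ℕ.* suc d) ≡ i / suc c * (j / suc d)
/-homo-* i j c d = toℚᵘ-injective (begin
  toℚᵘ ((i ℤ.* j) / (suc c ℕ.* suc d))     ≈⟨ toℚᵘ-/ _ _ ⟩
  ℚᵘ.mkℚᵘ i c ℚᵘ.* ℚᵘ.mkℚᵘ j d             ≈⟨ ℚᵘ.*-cong (toℚᵘ-/ i c) (toℚᵘ-/ j d) ⟨
  toℚᵘ (i / suc c) ℚᵘ.* toℚᵘ (j / suc d)   ≈⟨ toℚᵘ-homo-* (i / suc c) (j / suc d) ⟨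
  toℚᵘ (i / suc c * (j / suc d))           ∎)
  where open ℚᵘ.≃-Reasoning

/1-homo‿- : ∀ i → (ℤ.- i) / 1 ≡ - (i / 1)
/1-homo‿- i = toℚᵘ-injective (begin
  toℚᵘ ((ℤ.- i) / 1)    ≈⟨ toℚᵘ-/ _ 0 ⟩
  ℚᵘ.- ℚᵘ.mkℚᵘ i 0      ≈⟨ ℚᵘ.-‿cong (toℚᵘ-/ i 0) ⟨
  ℚᵘ.- toℚᵘ (i / 1)     ≈⟨ toℚᵘ-homo‿- (i / 1) ⟨
  toℚᵘ (- (i / 1))      ∎)
  where open ℚᵘ.≃-Reasoning

ℤ⟶ℚ : CommutativeRing.rawRing ℤ.+-*-commutativeRing
        -Raw-AlmostCommutative⟶ fromCommutativeRing +-*-commutativeRing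
ℤ⟶ℚ = record
  { ⟦_⟧    = _/ 1
  ; +-homo = /1-homo-+
  ; *-homo = λ i j → /-homo-* i j 0 0
  ; -‿homo = /1-homo‿-
  ; 0-homo = refl
  ; 1-homo = refl
  }

-- Integer coefficients keep normalisation free of the gcd computations of ℚ.
module Solver = RingSolver _ _ ℤ⟶ℚ (λ i j → Maybe.map (cong (_/ 1)) (dec⇒maybe (i ℤ.≟ j)))
open Solver using (Polynomial; solve; con; _:=_; _:+_; _:-_; _:*_)

ℕ→ℚ-suc : ∀ k → ℕ→ℚ (suc k) ≡ 1ℚ + ℕ→ℚ k
ℕ→ℚ-suc k = /1-homo-+ (+ 1) (+ k)

invℕ-* : ∀ a b → invℕ (a ℕ.* b) ≡ invℕ a * invℕ b
invℕ-* zero    b       = sym (*-zeroˡ (invℕ b))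
invℕ-* (suc a) zero    = trans (cong invℕ (ℕ.*-zeroʳ a)) (sym (*-zeroʳ (invℕ (suc a))))
invℕ-* (suc a) (suc b) = /-homo-* (+ 1) (+ 1) a b

invℕ-inverseˡ : ∀ k → invℕ (suc k) * ℕ→ℚ (suc k) ≡ 1ℚ
invℕ-inverseˡ k = toℚᵘ-injective (begin
  toℚᵘ (invℕ (suc k) * ℕ→ℚ (suc k))             ≈⟨ toℚᵘ-homo-* (invℕ (suc k)) (ℕ→ℚ (suc k)) ⟩
  toℚᵘ (invℕ (suc k)) ℚᵘ.* toℚᵘ (ℕ→ℚ (suc k))   ≈⟨ ℚᵘ.*-cong (toℚᵘ-/ (+ 1) k) (toℚᵘ-/ (+ suc k) 0) ⟩
  ℚᵘ.mkℚᵘ (+ 1) k ℚᵘ.* ℚᵘ.mkℚᵘ (+ suc k) 0      ≈⟨ ℚᵘ.*≡* (cong +_ (trans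
    (ℕ.*-identityʳ (1 ℕ.* suc k)) (cong (1 ℕ.*_) (sym (ℕ.*-identityʳ (suc k)))))) ⟩
  ℚᵘ.1ℚᵘ                                        ∎)
  where open ℚᵘ.≃-Reasoning

invℕ-cancel : ∀ k x → invℕ (suc k) * (ℕ→ℚ (suc k) * x) ≡ x
invℕ-cancel k x = begin
  invℕ (suc k) * (ℕ→ℚ (suc k) * x)   ≡⟨ *-assoc (invℕ (suc k)) (ℕ→ℚ (suc k)) x ⟨
  invℕ (suc k) * ℕ→ℚ (suc k) * x     ≡⟨ cong (_* x) (invℕ-inverseˡ k) ⟩
  1ℚ * x                             ≡⟨ *-identityˡ x ⟩
  x                                  ∎
  where open ≡-Reasoning

-- Moments and cumulants

-- The moment formulas are written over an arbitrary arithmetic so that one definition serves both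
-- as a function on ℚ and as input to the ring solver.
record Arithmetic (A : Set) : Set where
  infixl 6 _⊕_ _⊖_
  infixl 7 _⊗_
  infixr 8 _^_
  field
    _⊕_ _⊖_ _⊗_ : A → A → A
    int         : ℕ → A

  _^_ : A → ℕ → A
  x ^ zero  = int 1
  x ^ suc k = x ⊗ x ^ k

  powers : A → Vec A 6
  powers x = Vec.map (x ^_) (1 ∷ 2 ∷ 3 ∷ 4 ∷ 5 ∷ 6 ∷ [])

  -- If hᵣ = Σ pᵢʳ then these are the cumulants of a sum of independent Bernoulli(pᵢ) variables.
  cumulants : Vec A 6 → Vec A 6
  cumulants (h₁ ∷ h₂ ∷ h₃ ∷ h₄ ∷ h₅ ∷ h₆ ∷ []) =
    h₁ ∷
    h₁ ⊖ h₂ ∷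
    h₁ ⊖ int 3 ⊗ h₂ ⊕ int 2 ⊗ h₃ ∷
    h₁ ⊖ int 7 ⊗ h₂ ⊕ int 12 ⊗ h₃ ⊖ int 6 ⊗ h₄ ∷
    h₁ ⊖ int 15 ⊗ h₂ ⊕ int 50 ⊗ h₃ ⊖ int 60 ⊗ h₄ ⊕ int 24 ⊗ h₅ ∷
    h₁ ⊖ int 31 ⊗ h₂ ⊕ int 180 ⊗ h₃ ⊖ int 390 ⊗ h₄ ⊕ int 360 ⊗ h₅ ⊖ int 120 ⊗ h₆ ∷ []

  -- Raw moments from cumulants, by mₛ₊₁ = Σⱼ C(s,j) κⱼ₊₁ mₛ₋ⱼ.
  moment : Fin 7 → Vec A 6 → A
  moment s (κ₁ ∷ κ₂ ∷ κ₃ ∷ κ₄ ∷ κ₅ ∷ κ₆ ∷ []) = select s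
    where
    m₁ = κ₁
    m₂ = κ₁ ⊗ m₁ ⊕ κ₂
    m₃ = κ₁ ⊗ m₂ ⊕ int 2 ⊗ κ₂ ⊗ m₁ ⊕ κ₃
    m₄ = κ₁ ⊗ m₃ ⊕ int 3 ⊗ κ₂ ⊗ m₂ ⊕ int 3 ⊗ κ₃ ⊗ m₁ ⊕ κ₄
    m₅ = κ₁ ⊗ m₄ ⊕ int 4 ⊗ κ₂ ⊗ m₃ ⊕ int 6 ⊗ κ₃ ⊗ m₂ ⊕ int 4 ⊗ κ₄ ⊗ m₁ ⊕ κ₅
    m₆ = κ₁ ⊗ m₅ ⊕ int 5 ⊗ κ₂ ⊗ m₄ ⊕ int 10 ⊗ κ₃ ⊗ m₃ ⊕ int 10 ⊗ κ₄ ⊗ m₂ ⊕ int 5 ⊗ κ₅ ⊗ m₁ ⊕ κ₆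
    select : Fin 7 → A
    select 0F = int 1
    select 1F = m₁
    select 2F = m₂
    select 3F = m₃
    select 4F = m₄
    select 5F = m₅
    select 6F = m₆

  -- Adding the constant `t` to a random variable changes its first cumulant only.
  translate : A → Vec A 6 → Vec A 6
  translate t (κ₁ ∷ κs) = t ⊕ κ₁ ∷ κs

  -- If `h` holds the power sums of the parameters of independent Bernoulli variables, this is the
  -- `s`-th raw moment of `t` plus their sum.
  shiftedMoment : Fin 7 → A → Vec A 6 → A
  shiftedMoment s t h = moment s (translate t (cumulants h))

  -- n times the s-th moment of Xₙ + c, where h holds the sums Σ_{i<n} i⁻ʳ.
  scaledMoment : Fin 7 → A → A → Vec A 6 → A
  scaledMoment s c N h =
    (int 0 ⊕ c) ^ toℕ s ⊖ (int 1 ⊕ c) ^ toℕ s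
      ⊕ ((N ⊖ int 1) ⊗ shiftedMoment s (int 0 ⊕ c) h ⊕ shiftedMoment s (int 1 ⊕ c) h)

  -- Order and bracketing of the terms copy the claimed formulas, so that over `ratArith` clauses 2
  -- to 6 unfold to them definitionally.
  scaledCentralMoment : Fin 7 → A → Vec A 6 → A
  scaledCentralMoment 0F N _ = N
  scaledCentralMoment 1F N _ = int 0
  scaledCentralMoment 2F N (h₁ ∷ h₂ ∷ _) = N ⊗ h₁ ⊖ N ⊗ h₂ ⊕ int 2 ⊗ h₁
  scaledCentralMoment 3F N (h₁ ∷ h₂ ∷ h₃ ∷ _) =
    N ⊗ h₁ ⊖ int 3 ⊗ N ⊗ h₂ ⊕ int 2 ⊗ N ⊗ h₃ ⊖ int 3 ⊗ h₁ ^ 2 ⊕ int 6 ⊗ h₁ ⊖ int 3 ⊗ h₂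
  scaledCentralMoment 4F N (h₁ ∷ h₂ ∷ h₃ ∷ h₄ ∷ _) =
    int 3 ⊗ N ⊗ h₁ ^ 2 ⊖ int 6 ⊗ N ⊗ h₁ ⊗ h₂ ⊕ int 3 ⊗ N ⊗ h₂ ^ 2 ⊕ int 4 ⊗ h₁ ^ 3 ⊕ N ⊗ h₁
      ⊖ int 7 ⊗ N ⊗ h₂ ⊕ int 12 ⊗ N ⊗ h₃ ⊖ int 6 ⊗ N ⊗ h₄ ⊖ int 6 ⊗ h₁ ^ 2 ⊕ int 14 ⊗ h₁
      ⊖ int 18 ⊗ h₂ ⊕ int 8 ⊗ h₃
  scaledCentralMoment 5F N (h₁ ∷ h₂ ∷ h₃ ∷ h₄ ∷ h₅ ∷ _) =
    int 0 ⊖ int 5 ⊗ h₁ ^ 4 ⊕ int 10 ⊗ N ⊗ h₁ ^ 2 ⊖ int 40 ⊗ N ⊗ h₁ ⊗ h₂ ⊕ int 20 ⊗ N ⊗ h₁ ⊗ h₃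
      ⊕ int 30 ⊗ N ⊗ h₂ ^ 2 ⊖ int 20 ⊗ N ⊗ h₂ ⊗ h₃ ⊕ int 10 ⊗ h₁ ^ 3 ⊕ N ⊗ h₁ ⊖ int 15 ⊗ N ⊗ h₂
      ⊕ int 50 ⊗ N ⊗ h₃ ⊖ int 60 ⊗ N ⊗ h₄ ⊕ int 24 ⊗ N ⊗ h₅ ⊕ int 5 ⊗ h₁ ^ 2 ⊖ int 30 ⊗ h₁ ⊗ h₂
      ⊕ int 15 ⊗ h₂ ^ 2 ⊕ int 30 ⊗ h₁ ⊖ int 75 ⊗ h₂ ⊕ int 80 ⊗ h₃ ⊖ int 30 ⊗ h₄
  scaledCentralMoment 6F N (h₁ ∷ h₂ ∷ h₃ ∷ h₄ ∷ h₅ ∷ h₆ ∷ []) =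
    int 6 ⊗ h₁ ^ 5 ⊕ int 15 ⊗ N ⊗ h₁ ^ 3 ⊖ int 45 ⊗ N ⊗ h₁ ^ 2 ⊗ h₂ ⊕ int 45 ⊗ N ⊗ h₁ ⊗ h₂ ^ 2
      ⊖ int 15 ⊗ N ⊗ h₂ ^ 3 ⊖ int 15 ⊗ h₁ ^ 4 ⊕ int 25 ⊗ N ⊗ h₁ ^ 2 ⊖ int 180 ⊗ N ⊗ h₁ ⊗ h₂
      ⊕ int 220 ⊗ N ⊗ h₁ ⊗ h₃ ⊖ int 90 ⊗ N ⊗ h₁ ⊗ h₄ ⊕ int 195 ⊗ N ⊗ h₂ ^ 2 ⊖ int 300 ⊗ N ⊗ h₂ ⊗ h₃
      ⊕ int 90 ⊗ N ⊗ h₂ ⊗ h₄ ⊕ int 40 ⊗ N ⊗ h₃ ^ 2 ⊕ int 20 ⊗ h₁ ^ 3 ⊕ N ⊗ h₁ ⊖ int 31 ⊗ N ⊗ h₂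
      ⊕ int 180 ⊗ N ⊗ h₃ ⊖ int 390 ⊗ N ⊗ h₄ ⊕ int 360 ⊗ N ⊗ h₅ ⊖ int 120 ⊗ N ⊗ h₆ ⊕ int 90 ⊗ h₁ ^ 2
      ⊖ int 330 ⊗ h₁ ⊗ h₂ ⊕ int 120 ⊗ h₁ ⊗ h₃ ⊕ int 225 ⊗ h₂ ^ 2 ⊖ int 120 ⊗ h₂ ⊗ h₃ ⊕ int 62 ⊗ h₁
      ⊖ int 270 ⊗ h₂ ⊕ int 520 ⊗ h₃ ⊖ int 450 ⊗ h₄ ⊕ int 144 ⊗ h₅

open Arithmetic

ratArith : Arithmetic ℚ
ratArith = record { _⊕_ = _+_ ; _⊖_ = _-_ ; _⊗_ = _*_ ; int = ℕ→ℚ }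

polyArith : ∀ {n} → Arithmetic (Polynomial n)
polyArith = record { _⊕_ = _:+_ ; _⊖_ = _:-_ ; _⊗_ = _:*_ ; int = λ k → con (+ k) }

-- The empty Bernoulli sum: the variable is the constant `t`.
shiftedMoment-0 : ∀ s t → shiftedMoment ratArith s t (Vec.replicate 6 0ℚ) ≡ pow t (toℕ s)
shiftedMoment-0 s t = go s t
  where
  equation : Fin 7 → Polynomial 1 → _
  equation s t = shiftedMoment polyArith s t (Vec.replicate 6 (con (+ 0))) := _^_ polyArith t (toℕ s)
  go : ∀ s t → shiftedMoment ratArith s t (Vec.replicate 6 0ℚ) ≡ pow t (toℕ s)
  -- `moment` reduces only at a concrete index, so each `s` is a separate polynomial identity.
  go 0F = solve 1 (equation 0F) refl
  go 1F = solve 1 (equation 1F) refl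
  go 2F = solve 1 (equation 2F) refl
  go 3F = solve 1 (equation 3F) refl
  go 4F = solve 1 (equation 4F) refl
  go 5F = solve 1 (equation 5F) refl
  go 6F = solve 1 (equation 6F) refl

-- Adding an independent Bernoulli(p) variable increases each power sum hᵣ by pʳ.
shiftedMoment-step : ∀ s p t h →
  (1ℚ - p) * shiftedMoment ratArith s t h + p * shiftedMoment ratArith s (1ℚ + t) h
    ≡ shiftedMoment ratArith s t (zipWith _+_ h (powers ratArith p))
shiftedMoment-step s p t (h₁ ∷ h₂ ∷ h₃ ∷ h₄ ∷ h₅ ∷ h₆ ∷ []) = go s p t h₁ h₂ h₃ h₄ h₅ h₆
  where
  equation : Fin 7 → (p t h₁ h₂ h₃ h₄ h₅ h₆ : Polynomial 8) → _
  equation s p t h₁ h₂ h₃ h₄ h₅ h₆ = let h = h₁ ∷ h₂ ∷ h₃ ∷ h₄ ∷ h₅ ∷ h₆ ∷ [] in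
    (con (+ 1) :- p) :* shiftedMoment polyArith s t h :+ p :* shiftedMoment polyArith s (con (+ 1) :+ t) h
      := shiftedMoment polyArith s t (zipWith _:+_ h (powers polyArith p))
  go : ∀ s p t h₁ h₂ h₃ h₄ h₅ h₆ → let h = h₁ ∷ h₂ ∷ h₃ ∷ h₄ ∷ h₅ ∷ h₆ ∷ [] in
    (1ℚ - p) * shiftedMoment ratArith s t h + p * shiftedMoment ratArith s (1ℚ + t) h
      ≡ shiftedMoment ratArith s t (zipWith _+_ h (powers ratArith p))
  go 0F = solve 8 (equation 0F) refl
  go 1F = solve 8 (equation 1F) refl
  go 2F = solve 8 (equation 2F) refl
  go 3F = solve 8 (equation 3F) refl
  go 4F = solve 8 (equation 4F) refl
  go 5F = solve 8 (equation 5F) refl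
  go 6F = solve 8 (equation 6F) refl

-- The mean is h₁, so the shift by -h₁ centres the variable. The result is a polynomial identity
-- with `N` and the six power sums as independent indeterminates.
scaledMoment-central : ∀ s N h →
  scaledMoment ratArith s (- Vec.head h) N h ≡ scaledCentralMoment ratArith s N h
scaledMoment-central s N (h₁ ∷ h₂ ∷ h₃ ∷ h₄ ∷ h₅ ∷ h₆ ∷ []) = go s N h₁ h₂ h₃ h₄ h₅ h₆
  where
  equation : Fin 7 → (N h₁ h₂ h₃ h₄ h₅ h₆ : Polynomial 7) → _
  equation s N h₁ h₂ h₃ h₄ h₅ h₆ = let h = h₁ ∷ h₂ ∷ h₃ ∷ h₄ ∷ h₅ ∷ h₆ ∷ [] in
    scaledMoment polyArith s (Solver.:- h₁) N h := scaledCentralMoment polyArith s N h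
  go : ∀ s N h₁ h₂ h₃ h₄ h₅ h₆ → let h = h₁ ∷ h₂ ∷ h₃ ∷ h₄ ∷ h₅ ∷ h₆ ∷ [] in
    scaledMoment ratArith s (- h₁) N h ≡ scaledCentralMoment ratArith s N h
  go 0F = solve 7 (equation 0F) refl
  go 1F = solve 7 (equation 1F) refl
  go 2F = solve 7 (equation 2F) refl
  go 3F = solve 7 (equation 3F) refl
  go 4F = solve 7 (equation 4F) refl
  go 5F = solve 7 (equation 5F) refl
  go 6F = solve 7 (equation 6F) refl

-- Powers of reciprocals and harmonic sums

pow≡^ : ∀ x s → _^_ ratArith x s ≡ pow x s
pow≡^ x zero    = refl
pow≡^ x (suc s) = cong (x *_) (pow≡^ x s)

-- Powers of `suc k` are nonzero, so the `suc`-`pred` guard in `H` cancels; multiplicativity of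
-- `invℕ` does the rest.
invℕ-^ : ∀ k r → + 1 / suc (ℕ.pred (suc k ℕ.^ r)) ≡ _^_ ratArith (invℕ (suc k)) r
invℕ-^ k r = trans (invℕ-nonZero (suc k ℕ.^ r) (ℕ.m^n≢0 (suc k) r)) (invℕ-power r)
  where
  invℕ-nonZero : ∀ m → ℕ.NonZero m → + 1 / suc (ℕ.pred m) ≡ invℕ m
  invℕ-nonZero (suc m) _ = refl
  invℕ-power : ∀ r → invℕ (suc k ℕ.^ r) ≡ _^_ ratArith (invℕ (suc k)) r
  invℕ-power zero    = refl
  invℕ-power (suc r) =
    trans (invℕ-* (suc k) (suc k ℕ.^ r)) (cong (invℕ (suc k) *_) (invℕ-power r))

harmonics : ℕ → Vec ℚ 6
harmonics n = Vec.map (H n) (1 ∷ 2 ∷ 3 ∷ 4 ∷ 5 ∷ 6 ∷ [])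

-- `H n` stops at n - 1, so passing from n = m + 1 to m + 2 adds the terms with i = m + 1, the
-- powers of one Bernoulli parameter.
harmonics-suc : ∀ m →
  harmonics (suc (suc m)) ≡ zipWith _+_ (harmonics (suc m)) (powers ratArith (invℕ (suc m)))
harmonics-suc m = cong (zipWith _+_ (harmonics (suc m)))
  (Vec.map-cong (invℕ-^ m) (1 ∷ 2 ∷ 3 ∷ 4 ∷ 5 ∷ 6 ∷ []))

-- The final misplacement count

-- Mean of f at the final number of misplaced passengers, when a passengers are misplaced so far and
-- a passenger who finds their own seat taken is about to choose among m free seats.
displaced : ℕ → (ℕ → ℚ) → ℕ → ℚ
displaced zero    f a = f a
displaced (suc m) f a = invℕ (suc m) * (ℕ→ℚ m * displaced m f a + displaced m f (suc a))

-- Telescoping: by definition (m + 1) times `displaced (suc m) f a` is the left side at `m`, so each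
-- induction step contributes one new summand.
displaced-sum : ∀ m f a →
  ℕ→ℚ m * displaced m f a + displaced m f (suc a) ≡ f (suc a) + sumTo m (λ l → displaced l f (suc a))
displaced-sum zero    f a = begin
  0ℚ * f a + f (suc a)   ≡⟨ cong (_+ f (suc a)) (*-zeroˡ (f a)) ⟩
  0ℚ + f (suc a)         ≡⟨ +-comm 0ℚ (f (suc a)) ⟩
  f (suc a) + 0ℚ         ∎
  where open ≡-Reasoning
displaced-sum (suc m) f a = begin
  ℕ→ℚ (suc m) * (invℕ (suc m) * previous) + next
    ≡⟨ cong (_+ next) (sym (*-assoc (ℕ→ℚ (suc m)) (invℕ (suc m)) previous)) ⟩
  ℕ→ℚ (suc m) * invℕ (suc m) * previous + next
    ≡⟨ cong (λ u → u * previous + next)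
         (trans (*-comm (ℕ→ℚ (suc m)) (invℕ (suc m))) (invℕ-inverseˡ m)) ⟩
  1ℚ * previous + next
    ≡⟨ cong (_+ next) (trans (*-identityˡ previous) (displaced-sum m f a)) ⟩
  f (suc a) + sumTo m (λ l → displaced l f (suc a)) + next
    ≡⟨ +-assoc (f (suc a)) _ next ⟩
  f (suc a) + (sumTo m (λ l → displaced l f (suc a)) + next) ∎
  where
  open ≡-Reasoning
  previous = ℕ→ℚ m * displaced m f a + displaced m f (suc a)
  next     = displaced (suc m) f (suc a)

-- The recursion that the process itself obeys: of the m + 1 free seats, one ends the disorder, and
-- each other one hands it to an owner who will find l free seats, l = 1, ..., m.
displaced-choice : ∀ m f a →
  displaced (suc m) f a ≡ invℕ (suc m) * (f (suc a) + sumTo m (λ l → displaced l f (suc a)))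
displaced-choice m f a = cong (invℕ (suc m) *_) (displaced-sum m f a)

-- The two-term recursion has weights m/(m + 1) and 1/(m + 1), which is the addition of an
-- independent Bernoulli(1/(m + 1)) variable, as in `shiftedMoment-step`.
displaced-moment : ∀ s c m a →
  displaced m (λ x → pow (ℕ→ℚ x + c) (toℕ s)) a
    ≡ shiftedMoment ratArith s (ℕ→ℚ a + c) (harmonics (suc m))
displaced-moment s c zero    a = sym (shiftedMoment-0 s (ℕ→ℚ a + c))
displaced-moment s c (suc m) a = begin
  p * (ℕ→ℚ m * displaced m f a + displaced m f (suc a))
    ≡⟨ cong₂ (λ x y → p * (ℕ→ℚ m * x + y)) (displaced-moment s c m a) (displaced-moment s c m (suc a)) ⟩
  p * (ℕ→ℚ m * M t + M (ℕ→ℚ (suc a) + c))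
    ≡⟨ cong (λ u → p * (ℕ→ℚ m * M t + M u))
         (trans (cong (_+ c) (ℕ→ℚ-suc a)) (+-assoc 1ℚ (ℕ→ℚ a) c)) ⟩
  p * (ℕ→ℚ m * M t + M (1ℚ + t))
    -- The weight pm is rewritten as p(1 + m) - p, so that p(m + 1) = 1 turns it into 1 - p.
    ≡⟨ solve 4 (λ p k x y → p :* (k :* x :+ y) := (p :* (con (+ 1) :+ k) :- p) :* x :+ p :* y)
         refl p (ℕ→ℚ m) (M t) (M (1ℚ + t)) ⟩
  (p * (1ℚ + ℕ→ℚ m) - p) * M t + p * M (1ℚ + t)
    ≡⟨ cong (λ u → (u - p) * M t + p * M (1ℚ + t))
         (trans (cong (p *_) (sym (ℕ→ℚ-suc m))) (invℕ-inverseˡ m)) ⟩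
  (1ℚ - p) * M t + p * M (1ℚ + t)
    ≡⟨ shiftedMoment-step s p t (harmonics (suc m)) ⟩
  shiftedMoment ratArith s t (zipWith _+_ (harmonics (suc m)) (powers ratArith p))
    ≡⟨ cong (shiftedMoment ratArith s t) (sym (harmonics-suc m)) ⟩
  shiftedMoment ratArith s t (harmonics (suc (suc m))) ∎
  where
  open ≡-Reasoning
  f = λ x → pow (ℕ→ℚ x + c) (toℕ s)
  p = invℕ (suc m)
  t = ℕ→ℚ a + c
  M = λ u → shiftedMoment ratArith s u (harmonics (suc m))

-- Expectations

∑ : {A : Set} → List A → (A → ℚ) → ℚ
∑ xs g = foldr (λ x acc → g x + acc) 0ℚ xs

E-return : {A : Set} (a : A) (g : A → ℚ) → E (return a) g ≡ g a
E-return a g = trans (+-identityʳ (1ℚ * g a)) (*-identityˡ (g a))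

E-cong : {A : Set} (d : Dist A) {g h : A → ℚ} → g ≗ h → E d g ≡ E d h
E-cong []            g≗h = refl
E-cong ((p , a) ∷ d) g≗h = cong₂ _+_ (cong (p *_) (g≗h a)) (E-cong d g≗h)

E-++ : {A : Set} (d e : Dist A) (g : A → ℚ) → E (d ++ e) g ≡ E d g + E e g
E-++ []            e g = sym (+-identityˡ (E e g))
E-++ ((p , a) ∷ d) e g =
  trans (cong (_+_ (p * g a)) (E-++ d e g)) (sym (+-assoc (p * g a) (E d g) (E e g)))

E-scale : {A : Set} (p : ℚ) (d : Dist A) (g : A → ℚ) →
  E (map (λ qb → p * proj₁ qb , proj₂ qb) d) g ≡ p * E d g
E-scale p []            g = sym (*-zeroʳ p)
E-scale p ((q , b) ∷ d) g = trans
  (cong₂ _+_ (*-assoc p q (g b)) (E-scale p d g))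
  (sym (*-distribˡ-+ p (q * g b) (E d g)))

E-bind : {A B : Set} (d : Dist A) (k : A → Dist B) (g : B → ℚ) →
  E (bind d k) g ≡ E d (λ a → E (k a) g)
E-bind []            k g = refl
E-bind ((p , a) ∷ d) k g = trans
  (E-++ (map (λ qb → p * proj₁ qb , proj₂ qb) (k a)) (bind d k) g)
  (cong₂ _+_ (E-scale p (k a) g) (E-bind d k g))

E-map : {A B : Set} (h : A → B) (d : Dist A) (g : B → ℚ) →
  E (map (λ pa → proj₁ pa , h (proj₂ pa)) d) g ≡ E d (g ∘ h)
E-map h []            g = refl
E-map h ((p , a) ∷ d) g = cong (_+_ (p * g (h a))) (E-map h d g)

E-equiprobable : {A : Set} (p : ℚ) (xs : List A) (g : A → ℚ) →
  E (map (λ y → p , y) xs) g ≡ p * ∑ xs g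
E-equiprobable p []       g = sym (*-zeroʳ p)
E-equiprobable p (x ∷ xs) g =
  trans (cong (_+_ (p * g x)) (E-equiprobable p xs g)) (sym (*-distribˡ-+ p (g x) (∑ xs g)))

E-chooseRandom : ∀ i x xs asg g →
  E (chooseRandom i (x ∷ xs , asg)) g
    ≡ invℕ (suc (length xs)) * ∑ (x ∷ xs) (λ j → g (sit i (x ∷ xs , asg) j))
E-chooseRandom i x xs asg g = trans
  (E-map (sit i (x ∷ xs , asg)) (uniform (x ∷ xs)) g)
  (E-equiprobable (invℕ (suc (length xs))) (x ∷ xs) (λ j → g (sit i (x ∷ xs , asg) j)))

-- Free seats

range : ℕ → ℕ → List ℕ
range i zero    = []
range i (suc k) = i ∷ range (suc i) k

-- The recursion of `applyUpTo` composes its function with `suc`, hence the generalisation from `id`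
-- to any `f` that adds `i`.
applyUpTo-range : ∀ f i k → (∀ x → f x ≡ i ℕ.+ x) → applyUpTo f k ≡ range i k
applyUpTo-range f i zero    f≗ = refl
applyUpTo-range f i (suc k) f≗ = cong₂ _∷_
  (trans (f≗ 0) (ℕ.+-identityʳ i))
  (applyUpTo-range (f ∘ suc) (suc i) k (λ x → trans (f≗ (suc x)) (ℕ.+-suc i x)))

upTo-range : ∀ n → upTo n ≡ range 0 n
upTo-range n = applyUpTo-range id 0 n (λ _ → refl)

length-range : ∀ i k → length (range i k) ≡ k
length-range i zero    = refl
length-range i (suc k) = cong suc (length-range (suc i) k)

range-fresh : ∀ {j} i k → j < i → All (_≢ j) (range i k)
range-fresh i zero    j<i = []
range-fresh i (suc k) j<i = ℕ.>⇒≢ j<i ∷ range-fresh (suc i) k (ℕ.m<n⇒m<1+n j<i)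

-- The substitution l = i + k - j reverses the summation. It indexes seat `j` by the number of free
-- seats that its displaced owner will find.
∑-range : ∀ i k (g φ : ℕ → ℚ) → (∀ j → i ≤ j → j < i ℕ.+ k → g j ≡ φ (i ℕ.+ k ∸ j)) →
  ∑ (range i k) g ≡ sumTo k φ
∑-range i zero    g φ eq = refl
∑-range i (suc k) g φ eq = begin
  g i + ∑ (range (suc i) k) g   ≡⟨ cong₂ _+_ head tail ⟩
  φ (suc k) + sumTo k φ         ≡⟨ +-comm (φ (suc k)) (sumTo k φ) ⟩
  sumTo k φ + φ (suc k)         ∎
  where
  open ≡-Reasoning
  head = trans (eq i ℕ.≤-refl (ℕ.m<m+n i (s≤s z≤n))) (cong φ (ℕ.m+n∸m≡n i (suc k)))
  tail = ∑-range (suc i) k g φ λ j i<j j<i+k → trans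
    (eq j (ℕ.<⇒≤ i<j) (subst (j <_) (sym (ℕ.+-suc i k)) j<i+k))
    (cong (λ u → φ (u ∸ j)) (ℕ.+-suc i k))

remove : ℕ → List ℕ → List ℕ
remove j = filter (λ x → ¬? (x ℕ.≟ j))

remove-head : ∀ j xs → remove j (j ∷ xs) ≡ remove j xs
remove-head j xs = filter-reject (λ x → ¬? (x ℕ.≟ j)) (λ j≢j → j≢j refl)

remove-tail : ∀ {x} j xs → x ≢ j → remove j (x ∷ xs) ≡ x ∷ remove j xs
remove-tail j xs x≢j = filter-accept (λ x → ¬? (x ℕ.≟ j)) x≢j

remove-absent : ∀ {j xs} → All (_≢ j) xs → remove j xs ≡ xs
remove-absent {j} = filter-all (λ x → ¬? (x ℕ.≟ j))

fresh⇒∉ : ∀ {j xs} → All (_≢ j) xs → j ∉ xs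
fresh⇒∉ fresh = All¬⇒¬Any (All.map (λ x≢j j≡x → x≢j (sym j≡x)) fresh)

-- The boarding process

misplacements : List (ℕ × ℕ) → ℕ
misplacements asg = misplaced ([] , asg)

misplacements-own : ∀ i asg → misplacements ((i , i) ∷ asg) ≡ misplacements asg
misplacements-own i asg =
  cong length (filter-reject (λ ij → ¬? (proj₁ ij ℕ.≟ proj₂ ij)) {i , i} {asg} (λ i≢i → i≢i refl))

misplacements-other : ∀ i j asg → i ≢ j → misplacements ((i , j) ∷ asg) ≡ suc (misplacements asg)
misplacements-other i j asg i≢j =
  cong length (filter-accept (λ ij → ¬? (proj₁ ij ℕ.≟ proj₂ ij)) i≢j)

board-own : ∀ i s → suc i ∈ proj₁ s → board (suc i) s ≡ return (sit (suc i) s (suc i))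
board-own i s i∈ with suc i ∈? proj₁ s
... | yes _  = refl
... | no  i∉ = contradiction i∈ i∉

board-taken : ∀ i s → suc i ∉ proj₁ s → board (suc i) s ≡ chooseRandom (suc i) s
board-taken i s i∉ with suc i ∈? proj₁ s
... | yes i∈ = contradiction i∈ i∉
... | no  _  = refl

expected : (ℕ → ℚ) → List ℕ → State → ℚ
expected f is s = E (boardAll is s) (f ∘ misplaced)

expected-∷ : ∀ f i is s → expected f (i ∷ is) s ≡ E (board i s) (expected f is)
expected-∷ f i is s = E-bind (board i s) (boardAll is) (f ∘ misplaced)

expected-own : ∀ f i is s → suc i ∈ proj₁ s →
  expected f (suc i ∷ is) s ≡ expected f is (sit (suc i) s (suc i))
expected-own f i is s i∈ = begin
  expected f (suc i ∷ is) s                             ≡⟨ expected-∷ f (suc i) is s ⟩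
  E (board (suc i) s) (expected f is)                   ≡⟨ cong (λ d → E d (expected f is)) (board-own i s i∈) ⟩
  E (return (sit (suc i) s (suc i))) (expected f is)    ≡⟨ E-return (sit (suc i) s (suc i)) (expected f is) ⟩
  expected f is (sit (suc i) s (suc i))                 ∎
  where open ≡-Reasoning

-- Every remaining passenger finds their own seat, so the count is frozen.
expected-orderly : ∀ f i k asg →
  expected f (range (suc i) k) (range (suc i) k , asg) ≡ f (misplacements asg)
expected-orderly f i zero    asg = E-return ([] , asg) (f ∘ misplaced)
expected-orderly f i (suc k) asg = begin
  expected f (suc i ∷ rest) (suc i ∷ rest , asg)
    ≡⟨ expected-own f i rest (suc i ∷ rest , asg) (here refl) ⟩
  expected f rest (remove (suc i) (suc i ∷ rest) , (suc i , suc i) ∷ asg)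
    ≡⟨ cong (λ free → expected f rest (free , (suc i , suc i) ∷ asg))
         (trans (remove-head (suc i) rest) (remove-absent (range-fresh (suc (suc i)) k ℕ.≤-refl))) ⟩
  expected f rest (rest , (suc i , suc i) ∷ asg)
    ≡⟨ expected-orderly f (suc i) k ((suc i , suc i) ∷ asg) ⟩
  f (misplacements ((suc i , suc i) ∷ asg))
    ≡⟨ cong f (misplacements-own (suc i) asg) ⟩
  f (misplacements asg) ∎
  where
  open ≡-Reasoning
  rest = range (suc (suc i)) k

-- Serves both passenger 0 and a displaced passenger. The count after taking seat 0 stays
-- unevaluated, since that seat is correct exactly for `i` = 0. The states after the other choices
-- enter as a hypothesis, to be supplied by the induction in `expected-displaced`.
expected-choice : ∀ f i k asg →
  (∀ asg j → i < j → j < suc i ℕ.+ k →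
    expected f (range (suc i) k) (0 ∷ remove j (range (suc i) k) , asg)
      ≡ displaced (suc i ℕ.+ k ∸ j) f (misplacements asg)) →
  E (chooseRandom i (0 ∷ range (suc i) k , asg)) (expected f (range (suc i) k))
    ≡ invℕ (suc k) * (f (misplacements ((i , 0) ∷ asg))
        + sumTo k (λ l → displaced l f (suc (misplacements asg))))
expected-choice f i k asg hyp = begin
  E (chooseRandom i (0 ∷ rest , asg)) (expected f rest)
    ≡⟨ E-chooseRandom i 0 rest asg (expected f rest) ⟩
  invℕ (suc (length rest)) * (after 0 + ∑ rest after)
    ≡⟨ cong₂ (λ l x → invℕ (suc l) * x) (length-range (suc i) k) (cong₂ _+_ home away) ⟩
  invℕ (suc k) * (f (misplacements ((i , 0) ∷ asg))
      + sumTo k (λ l → displaced l f (suc (misplacements asg)))) ∎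
  where
  open ≡-Reasoning
  rest  = range (suc i) k
  after = λ j → expected f rest (sit i (0 ∷ rest , asg) j)
  home  = trans
    (cong (λ free → expected f rest (free , (i , 0) ∷ asg))
      (trans (remove-head 0 rest) (remove-absent (range-fresh (suc i) k (s≤s z≤n)))))
    (expected-orderly f i k ((i , 0) ∷ asg))
  away  = ∑-range (suc i) k after (λ l → displaced l f (suc (misplacements asg))) λ j i<j j<i+k → begin
    expected f rest (remove j (0 ∷ rest) , (i , j) ∷ asg)
      ≡⟨ cong (λ free → expected f rest (free , (i , j) ∷ asg))
           (remove-tail j rest (ℕ.<⇒≢ (ℕ.≤-<-trans z≤n i<j))) ⟩
    expected f rest (0 ∷ remove j rest , (i , j) ∷ asg)
      ≡⟨ hyp ((i , j) ∷ asg) j i<j j<i+k ⟩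
    displaced (suc i ℕ.+ k ∸ j) f (misplacements ((i , j) ∷ asg))
      ≡⟨ cong (displaced (suc i ℕ.+ k ∸ j) f) (misplacements-other i j asg (ℕ.<⇒≢ i<j)) ⟩
    displaced (suc i ℕ.+ k ∸ j) f (suc (misplacements asg)) ∎

-- Invariant while the owner of the taken seat `j` has yet to board: seat 0 and all later seats
-- except `j` are free. With n = suc i + k seats in total, that owner will choose among seat 0 and
-- the seats beyond `j`, which are n - j seats.
expected-displaced : ∀ f k i asg j → i < j → j < suc i ℕ.+ k →
  expected f (range (suc i) k) (0 ∷ remove j (range (suc i) k) , asg)
    ≡ displaced (suc i ℕ.+ k ∸ j) f (misplacements asg)
expected-displaced f zero    i asg j i<j j<i+k =
  contradiction (subst (j <_) (ℕ.+-identityʳ (suc i)) j<i+k) (ℕ.≤⇒≯ i<j)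
expected-displaced f (suc k) i asg j i<j j<i+k with suc i ℕ.≟ j
... | yes refl = begin
  expected f (suc i ∷ rest) (0 ∷ remove (suc i) (suc i ∷ rest) , asg)
    ≡⟨ cong (λ free → expected f (suc i ∷ rest) (0 ∷ free , asg))
         (trans (remove-head (suc i) rest) (remove-absent fresh)) ⟩
  expected f (suc i ∷ rest) (0 ∷ rest , asg)
    ≡⟨ expected-∷ f (suc i) rest (0 ∷ rest , asg) ⟩
  E (board (suc i) (0 ∷ rest , asg)) (expected f rest)
    ≡⟨ cong (λ d → E d (expected f rest)) (board-taken i (0 ∷ rest , asg) (fresh⇒∉ ((λ ()) ∷ fresh))) ⟩
  E (chooseRandom (suc i) (0 ∷ rest , asg)) (expected f rest)
    -- The owner of `j` chooses; any new displacement is covered by the induction hypothesis at the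
    -- smaller `k`.
    ≡⟨ expected-choice f (suc i) k asg (expected-displaced f k (suc i)) ⟩
  invℕ (suc k) * (f (misplacements ((suc i , 0) ∷ asg))
      + sumTo k (λ l → displaced l f (suc (misplacements asg))))
    ≡⟨ cong (λ a → invℕ (suc k) * (f a + sumTo k (λ l → displaced l f (suc (misplacements asg)))))
         (misplacements-other (suc i) 0 asg (λ ())) ⟩
  invℕ (suc k) * (f (suc (misplacements asg)) + sumTo k (λ l → displaced l f (suc (misplacements asg))))
    ≡⟨ sym (displaced-choice k f (misplacements asg)) ⟩
  displaced (suc k) f (misplacements asg)
    ≡⟨ cong (λ m → displaced m f (misplacements asg)) (sym (ℕ.m+n∸m≡n (suc i) (suc k))) ⟩
  displaced (suc i ℕ.+ suc k ∸ suc i) f (misplacements asg) ∎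
  where
  open ≡-Reasoning
  rest = range (suc (suc i)) k
  fresh = range-fresh (suc (suc i)) k ℕ.≤-refl
... | no 1+i≢j = begin
  expected f (suc i ∷ rest) (0 ∷ remove j (suc i ∷ rest) , asg)
    ≡⟨ cong (λ free → expected f (suc i ∷ rest) (0 ∷ free , asg)) (remove-tail j rest 1+i≢j) ⟩
  expected f (suc i ∷ rest) (0 ∷ suc i ∷ remove j rest , asg)
    -- A passenger boarding before `j` sits correctly and leaves the invariant intact.
    ≡⟨ expected-own f i rest (0 ∷ suc i ∷ remove j rest , asg) (there (here refl)) ⟩
  expected f rest (remove (suc i) (0 ∷ suc i ∷ remove j rest) , (suc i , suc i) ∷ asg)
    ≡⟨ cong (λ free → expected f rest (free , (suc i , suc i) ∷ asg)) remaining ⟩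
  expected f rest (0 ∷ remove j rest , (suc i , suc i) ∷ asg)
    ≡⟨ expected-displaced f k (suc i) ((suc i , suc i) ∷ asg) j
         (ℕ.≤∧≢⇒< i<j 1+i≢j) (subst (j <_) (ℕ.+-suc (suc i) k) j<i+k) ⟩
  displaced (suc (suc i) ℕ.+ k ∸ j) f (misplacements ((suc i , suc i) ∷ asg))
    ≡⟨ cong₂ (λ m a → displaced (m ∸ j) f a) (sym (ℕ.+-suc (suc i) k)) (misplacements-own (suc i) asg) ⟩
  displaced (suc i ℕ.+ suc k ∸ j) f (misplacements asg) ∎
  where
  open ≡-Reasoning
  rest = range (suc (suc i)) k
  remaining : remove (suc i) (0 ∷ suc i ∷ remove j rest) ≡ 0 ∷ remove j rest
  remaining = trans (remove-tail (suc i) (suc i ∷ remove j rest) (λ ())) (cong (0 ∷_) (trans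
    (remove-head (suc i) (remove j rest))
    (remove-absent (filter⁺ (λ x → ¬? (x ℕ.≟ j)) (range-fresh (suc (suc i)) k ℕ.≤-refl)))))

-- Moments of the number of misplaced passengers

E-process : ∀ f m → E (process (suc m)) (f ∘ misplaced)
  ≡ invℕ (suc m) * (f 0 - f 1 + (ℕ→ℚ m * displaced m f 0 + displaced m f 1))
E-process f m = begin
  E (process (suc m)) (f ∘ misplaced)
    ≡⟨ cong (λ seats → expected f seats (seats , [])) (upTo-range (suc m)) ⟩
  expected f (0 ∷ range 1 m) (0 ∷ range 1 m , [])
    ≡⟨ expected-∷ f 0 (range 1 m) (0 ∷ range 1 m , []) ⟩
  E (chooseRandom 0 (0 ∷ range 1 m , [])) (expected f (range 1 m))
    ≡⟨ expected-choice f 0 m [] (expected-displaced f m 0) ⟩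
  invℕ (suc m) * (f 0 + S)
    -- Passenger 0 chooses as a displaced passenger would, but seat 0 is their own and yields `f 0`.
    -- Adding and subtracting `f 1` restores the sum in `displaced-sum`.
    ≡⟨ cong (invℕ (suc m) *_)
         (solve 3 (λ x y z → x :+ z := x :- y :+ (y :+ z)) refl (f 0) (f 1) S) ⟩
  invℕ (suc m) * (f 0 - f 1 + (f 1 + S))
    ≡⟨ cong (λ u → invℕ (suc m) * (f 0 - f 1 + u)) (sym (displaced-sum m f 0)) ⟩
  invℕ (suc m) * (f 0 - f 1 + (ℕ→ℚ m * displaced m f 0 + displaced m f 1)) ∎
  where
  open ≡-Reasoning
  S = sumTo m (λ l → displaced l f 1)

E-process-moment : ∀ s c m → E (process (suc m)) (λ st → pow (Xn st + c) (toℕ s))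
  ≡ invℕ (suc m) * scaledMoment ratArith s c (ℕ→ℚ (suc m)) (harmonics (suc m))
E-process-moment s c m = begin
  E (process (suc m)) (f ∘ misplaced)
    ≡⟨ E-process f m ⟩
  invℕ (suc m) * (f 0 - f 1 + (ℕ→ℚ m * displaced m f 0 + displaced m f 1))
    ≡⟨ cong (invℕ (suc m) *_) (cong₂ _+_
         (cong₂ _-_ (sym (pow≡^ (0ℚ + c) (toℕ s))) (sym (pow≡^ (1ℚ + c) (toℕ s))))
         (cong₂ _+_ (cong₂ _*_ pred-N (displaced-moment s c m 0)) (displaced-moment s c m 1))) ⟩
  invℕ (suc m) * scaledMoment ratArith s c (ℕ→ℚ (suc m)) (harmonics (suc m)) ∎
  where
  open ≡-Reasoning
  f = λ x → pow (ℕ→ℚ x + c) (toℕ s)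
  pred-N : ℕ→ℚ m ≡ ℕ→ℚ (suc m) - 1ℚ
  pred-N = trans (solve 1 (λ k → k := con (+ 1) :+ k :- con (+ 1)) refl (ℕ→ℚ m))
    (cong (_- 1ℚ) (sym (ℕ→ℚ-suc m)))

meanX≡H : ∀ m → meanX (suc m) ≡ H (suc m) 1
meanX≡H m = begin
  E (process (suc m)) Xn
    ≡⟨ E-cong (process (suc m))
         (λ st → solve 1 (λ x → x := (x :+ con (+ 0)) :* con (+ 1)) refl (Xn st)) ⟩
  E (process (suc m)) (λ st → pow (Xn st + 0ℚ) 1)
    ≡⟨ E-process-moment 1F 0ℚ m ⟩
  invℕ (suc m) * scaledMoment ratArith 1F 0ℚ N (harmonics (suc m))
    -- The first moment reads only the head of the vector; the variable `h` fills the other five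
    -- places.
    ≡⟨ cong (invℕ (suc m) *_) (solve 2 (λ N h →
         scaledMoment polyArith 1F (con (+ 0)) N (h ∷ h ∷ h ∷ h ∷ h ∷ h ∷ []) := N :* h)
         refl N (H (suc m) 1)) ⟩
  invℕ (suc m) * (N * H (suc m) 1)
    ≡⟨ invℕ-cancel m (H (suc m) 1) ⟩
  H (suc m) 1 ∎
  where
  open ≡-Reasoning
  N = ℕ→ℚ (suc m)

centralMoment-process : ∀ s m → centralMoment (suc m) (toℕ s)
  ≡ invℕ (suc m) * scaledCentralMoment ratArith s (ℕ→ℚ (suc m)) (harmonics (suc m))
centralMoment-process s m = begin
  centralMoment (suc m) (toℕ s)
    -- Subtraction in ℚ unfolds to adding the negative, so the shift is minus the mean.
    ≡⟨ E-process-moment s (- meanX (suc m)) m ⟩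
  invℕ (suc m) * scaledMoment ratArith s (- meanX (suc m)) N h
    ≡⟨ cong (λ μ → invℕ (suc m) * scaledMoment ratArith s (- μ) N h) (meanX≡H m) ⟩
  invℕ (suc m) * scaledMoment ratArith s (- H (suc m) 1) N h
    ≡⟨ cong (invℕ (suc m) *_) (scaledMoment-central s N h) ⟩
  invℕ (suc m) * scaledCentralMoment ratArith s N h ∎
  where
  open ≡-Reasoning
  N = ℕ→ℚ (suc m)
  h = harmonics (suc m)

theorem5 : (n : ℕ) → 2 ≤ n →
  let N  = ℕ→ℚ n
      c  = λ k → ℕ→ℚ k
      H₁ = H n 1
      H₂ = H n 2
      H₃ = H n 3
      H₄ = H n 4
      H₅ = H n 5
      H₆ = H n 6
  in (meanX n ≡ H₁)
   × (varX n ≡ invℕ n * (N * H₁ - N * H₂ + c 2 * H₁))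
   × (centralMoment n 3 ≡ invℕ n * (N * H₁ - c 3 * N * H₂ + c 2 * N * H₃ - c 3 * pow H₁ 2 + c 6 * H₁ - c 3 * H₂))
   × (centralMoment n 4 ≡ invℕ n * (c 3 * N * pow H₁ 2 - c 6 * N * H₁ * H₂ + c 3 * N * pow H₂ 2 + c 4 * pow H₁ 3
        + N * H₁ - c 7 * N * H₂ + c 12 * N * H₃ - c 6 * N * H₄ - c 6 * pow H₁ 2 + c 14 * H₁ - c 18 * H₂ + c 8 * H₃))
   × (centralMoment n 5 ≡ invℕ n * (c 0 - c 5 * pow H₁ 4 + c 10 * N * pow H₁ 2 - c 40 * N * H₁ * H₂ + c 20 * N * H₁ * H₃
        + c 30 * N * pow H₂ 2 - c 20 * N * H₂ * H₃ + c 10 * pow H₁ 3 + N * H₁ - c 15 * N * H₂ + c 50 * N * H₃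
        - c 60 * N * H₄ + c 24 * N * H₅
        + c 5 * pow H₁ 2 - c 30 * H₁ * H₂ + c 15 * pow H₂ 2 + c 30 * H₁ - c 75 * H₂ + c 80 * H₃ - c 30 * H₄))
   × (centralMoment n 6 ≡ invℕ n * (c 6 * pow H₁ 5 + c 15 * N * pow H₁ 3 - c 45 * N * pow H₁ 2 * H₂ + c 45 * N * H₁ * pow H₂ 2
        - c 15 * N * pow H₂ 3 - c 15 * pow H₁ 4 + c 25 * N * pow H₁ 2 - c 180 * N * H₁ * H₂ + c 220 * N * H₁ * H₃
        - c 90 * N * H₁ * H₄
        + c 195 * N * pow H₂ 2 - c 300 * N * H₂ * H₃ + c 90 * N * H₂ * H₄ + c 40 * N * pow H₃ 2 + c 20 * pow H₁ 3
        + N * H₁ - c 31 * N * H₂ + c 180 * N * H₃ - c 390 * N * H₄ + c 360 * N * H₅ - c 120 * N * H₆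
        + c 90 * pow H₁ 2 - c 330 * H₁ * H₂ + c 120 * H₁ * H₃ + c 225 * pow H₂ 2 - c 120 * H₂ * H₃ + c 62 * H₁
        - c 270 * H₂ + c 520 * H₃ - c 450 * H₄ + c 144 * H₅))
theorem5 (suc m) _ =
  meanX≡H m ,
  centralMoment-process 2F m ,
  centralMoment-process 3F m ,
  centralMoment-process 4F m ,
  centralMoment-process 5F m ,
  centralMoment-process 6F m
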